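{- The VC-dimension of any Latin square graph of order at least $225$ (that is, with at least $225$ vertices) is $4$.
   Context: All graphs are finite and simple. A Latin square of order $m$ is an $m\times m$ matrix $L$ with entries in $[m]=\{1,\dots,m\}$ such that each row and each column contains each entry exactly once. Its Latin square graph $G(L)$ has vertex set $\{(i,j,L_{i,j}):i,j\in[m]\}$, where two distinct vertices $(i,j,L_{i,j})$ and $(k,\ell,L_{k,\ell})$ are adjacent if and only if $i=k$, $j=\ell$, or $L_{i,j}=L_{k,\ell}$. The order of the Latin square graph is its number of vertices $m^2$ (the square of the order of the Latin square). The VC-dimension of a graph $G$ is the maximum size of a set $S\subseteq V(G)$ that is shattered, meaning that for every $A\subseteq S$ there is a vertex $u\in V(G)$ (possibly $u\in S$) with $N(u)\cap S=A$, where $N(u)$ is the open neighborhood of $u$. -}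

module Defs where

open import Data.Fin.Base using (Fin)
open import Data.Fin.Properties using (*↔×)
open import Data.List.Base using (List; length)
open import Data.List.Membership.Propositional using (_∈_)
open import Data.List.Relation.Binary.Subset.Propositional using (_⊆_)
open import Data.List.Relation.Unary.Unique.Propositional using (Unique)
open import Data.Nat.Base using (ℕ; _*_; _≤_)
open import Data.Product.Base using (∃; _×_; _,_; proj₁; map)
open import Data.Product using (∃!)
open import Data.Sum.Base using (_⊎_) renaming (map to map-⊎)
open import Function.Bundles using (_↔_; mk↔ₛ′)
open import Function.Properties.Inverse using (↔-sym; ↔-trans)
open import Level using (0ℓ)
open import Relation.Binary.Core using (Rel)
open import Relation.Binary.Definitions using (Symmetric; Irreflexive)
open import Relation.Binary.PropositionalEquality
  using (_≡_; _≢_; refl; sym; ≢-sym)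
open import Relation.Unary using (Pred; _∩_; _≐_)

record Graph : Set₁ where
  field
    V        : Set
    _~_      : Rel V 0ℓ
    ~-sym    : Symmetric _~_
    ~-irrefl : Irreflexive _≡_ _~_
    order    : ℕ
    finite   : V ↔ Fin order

  N : V → Pred V 0ℓ
  N u = u ~_

  -- Finite sets of vertices are lists, considered up to membership.
  Shattered : List V → Set
  Shattered S = ∀ (A : List V) → A ⊆ S → ∃ λ u → (N u ∩ (_∈ S)) ≐ (_∈ A)

-- Uniqueness makes the length of a list the size of the set it denotes.
record VCDimension (G : Graph) (d : ℕ) : Set where
  open Graph G
  field
    attained : ∃ λ (S : List V) → Unique S × length S ≡ d × Shattered S
    maximal  : ∀ (S : List V) → Unique S → Shattered S → length S ≤ d

record LatinSquare (m : ℕ) : Set where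
  field
    entry  : Fin m → Fin m → Fin m
    row    : ∀ i k → ∃! _≡_ λ j → entry i j ≡ k
    column : ∀ j k → ∃! _≡_ λ i → entry i j ≡ k

module _ {m : ℕ} (L : LatinSquare m) where
  open LatinSquare L using (entry)

  record Cell : Set where
    constructor cell
    field
      rowOf    : Fin m
      colOf    : Fin m
      symbolOf : Fin m
      isEntry  : entry rowOf colOf ≡ symbolOf

  open Cell

  Adjacent : Rel Cell 0ℓ
  Adjacent u v =
    u ≢ v × (rowOf u ≡ rowOf v ⊎ colOf u ≡ colOf v ⊎ symbolOf u ≡ symbolOf v)

  Cell↔Fin : Cell ↔ Fin (m * m)
  Cell↔Fin = ↔-trans Cell↔× (↔-sym *↔×)
    where
    Cell↔× : Cell ↔ (Fin m × Fin m)
    Cell↔× = mk↔ₛ′ (λ c → rowOf c , colOf c) (λ (i , j) → cell i j (entry i j) refl)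
      (λ _ → refl) (λ { (cell _ _ _ refl) → refl })

  latinSquareGraph : Graph
  latinSquareGraph = record
    { V        = Cell
    ; _~_      = Adjacent
    ; ~-sym    = map ≢-sym (map-⊎ sym (map-⊎ sym sym))
    ; ~-irrefl = λ u≡v u~v → proj₁ u~v u≡v
    ; order    = m * m
    ; finite   = Cell↔Fin
    }

{-# OPTIONS --safe #-}
module Submission where

-- Rows, columns and symbols are three parallel classes of lines: points that agree in two
-- of the classes coincide, and lines of different classes meet in one point.
--
-- Upper bound. A vertex adjacent to all of five points lies with two of them, a and b, on
-- one line ℓ. Off ℓ, a and b have at most two common neighbours. If a third point c of the set
-- were on ℓ, then c would be the only point of ℓ not adjacent to c, so three points would have to
-- realise the four cuts that contain a, b and omit c. So c is off ℓ, and the four cuts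
-- containing a, b, c are realised by the two neighbours of c on ℓ and the two common neighbours
-- of a and b off ℓ; hence the latter are adjacent to c, and likewise to every point of the set.
-- Then the three cuts containing a, b, c but not the whole set are realised by the two
-- neighbours of c on ℓ, a contradiction.
--
-- Lower bound. Take a, b on the row and c, d on the column of a point u, in general position:
-- u realises abcd, the point of the row with the symbol of c realises abc, the point in
-- the row of c and the column of a realises ac, and the cuts of the remaining shapes
-- are realised by generic points of the row, of the column of a, or of the whole square.

open import Defs
open import Data.Nat.Base using (ℕ; _≤_)

open import Data.Bool.Base using (Bool; true; false; T)
open import Data.Bool.Properties using (T?)
open import Data.Empty using (⊥)
open import Data.Fin.Base as Fin using (Fin; zero; suc; punchIn; punchOut; inject₁; inject≤)
open import Data.Fin.Patterns using (0F; 1F; 2F; 3F; 4F)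
open import Data.Fin.Permutation as Perm using (Permutation′; _⟨$⟩ʳ_; _⟨$⟩ˡ_; transpose; insert)
open import Data.Fin.Properties as Fin
  using (_≟_; pigeonhole; punchInᵢ≢i; punchOut-injective; punchIn-punchOut; ¬∀⟶∃¬; <⇒≢)
open import Data.List.Base using (List; []; _∷_; length; map; filter; lookup; allFin)
open import Data.List.Membership.Propositional using (_∈_; _∉_)
open import Data.List.Membership.Propositional.Properties
  using (∈-map⁺; ∈-map⁻; ∈-filter⁺; ∈-filter⁻; ∈-allFin; ∈-lookup)
import Data.List.Membership.DecPropositional as DecMembership
open import Data.List.Properties using (length-map)
open import Data.List.Relation.Unary.All as All using (All; []; _∷_)
open import Data.List.Relation.Unary.AllPairs using ([]; _∷_)
open import Data.List.Relation.Unary.Any using (here; there; index)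
open import Data.List.Relation.Unary.Any.Properties using (lookup-index)
open import Data.List.Relation.Unary.Unique.Propositional using (Unique)
open import Data.Nat.Base using (zero; suc; _<_; _*_; s≤s)
open import Data.Nat.Properties using (≤-trans; ≤-<-trans; ≤-refl; ≮⇒≥; *-mono-≤; _≤?_; _<?_)
open import Data.Product.Base using (∃; ∃₂; _×_; _,_; proj₁; proj₂)
open import Data.Sum.Base using (inj₁; inj₂)
open import Data.Unit.Base using (⊤; tt)
open import Data.Vec.Base as Vec using (Vec; []; _∷_)
open import Function.Base using (_∘_; case_of_)
open import Function.Definitions using (Injective)
open import Relation.Binary.Definitions using (DecidableEquality)
open import Relation.Binary.PropositionalEquality
  using (_≡_; _≢_; refl; sym; trans; cong; subst; ≢-sym)
open import Relation.Nullary using (¬_; yes; no; does; proof; contradiction)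
open import Relation.Nullary.Decidable using (True; toWitness; from-yes; from-no; decidable-stable; map′; _×-dec_)
open import Relation.Nullary.Reflects using (Reflects; ofʸ; ofⁿ; invert; det; fromEquivalence)

-- Pigeonhole tools on finite types.

Reflects-transfer : ∀ {P Q : Set} {b} → Reflects P b → Reflects Q b → P → Q
Reflects-transfer (ofʸ _)  (ofʸ q) _ = q
Reflects-transfer (ofⁿ ¬p) (ofⁿ _) p = contradiction p ¬p

fresh : ∀ {m} (xs : List (Fin m)) → length xs < m → ∃ λ i → i ∉ xs
fresh {m} xs short = ¬∀⟶∃¬ m (_∈ xs) (_∈? xs) not-all
  where
  open DecMembership (_≟_ {m}) using (_∈?_)
  not-all : ¬ (∀ i → i ∈ xs)
  not-all all with pigeonhole short (index ∘ all)
  ... | i , j , i<j , eq = <⇒≢ i<j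
    (trans (lookup-index (all i)) (trans (cong (lookup xs) eq) (sym (lookup-index (all j)))))

lookup-injective : ∀ {A : Set} {xs : List A} → Unique xs → Injective _≡_ _≡_ (lookup xs)
lookup-injective (_ ∷ _)  {zero}  {zero}  _  = refl
lookup-injective (x≢ ∷ _) {zero}  {suc j} eq = contradiction eq (All.lookup x≢ (∈-lookup j))
lookup-injective (x≢ ∷ _) {suc i} {zero}  eq = contradiction (sym eq) (All.lookup x≢ (∈-lookup i))
lookup-injective (_ ∷ u)  {suc i} {suc j} eq = cong suc (lookup-injective u eq)

-- Punching out `k` and then `l` leaves a type with one element. This is how "the remaining
-- direction" becomes well defined.
third-unique : ∀ {k l x y : Fin 3} → k ≢ l → k ≢ x → k ≢ y → l ≢ x → l ≢ y → x ≡ y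
third-unique {k} k≢l k≢x k≢y l≢x l≢y =
  punchOut-injective k≢x k≢y (punchOut-injective l≢x′ l≢y′ (one _ _))
  where
  l≢x′ : punchOut k≢l ≢ punchOut k≢x
  l≢x′ = l≢x ∘ punchOut-injective k≢l k≢x
  l≢y′ : punchOut k≢l ≢ punchOut k≢y
  l≢y′ = l≢y ∘ punchOut-injective k≢l k≢y
  one : (i j : Fin 1) → i ≡ j
  one 0F 0F = refl

-- A pigeonhole principle in which labels are relations, so no canonical label has to be computed.
-- Each counting argument below lists a few positions, each held by at most one vertex, and then
-- exhibits too many vertices.
crowded : ∀ {n k} {A : Set} (Label : A → Fin k → Set) →
          (∀ {v w l} → Label v l → Label w l → v ≡ w) →
          k < n → (f : Fin n → A) → (∀ i → ∃ (Label (f i))) →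
          ∃₂ λ i j → i Fin.< j × f i ≡ f j
crowded Label functional k<n f label with pigeonhole k<n (proj₁ ∘ label)
... | i , j , i<j , eq = i , j , i<j ,
  functional (proj₂ (label i)) (subst (Label (f j)) (sym eq) (proj₂ (label j)))

module _ {m : ℕ} (L : LatinSquare m) where
  open LatinSquare L
  open Graph (latinSquareGraph L) using (Shattered)
  open Cell

  -- Points and the three parallel classes of lines.

  Point : Set
  Point = Cell L

  infix 4 _~_
  _~_ : Point → Point → Set
  _~_ = Adjacent L

  coord : Fin 3 → Point → Fin m
  coord 0F = rowOf
  coord 1F = colOf
  coord 2F = symbolOf

  infix 4 _≈[_]_ _≉[_]_
  _≈[_]_ _≉[_]_ : Point → Fin 3 → Point → Set
  x ≈[ k ] y = coord k x ≡ coord k y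
  x ≉[ k ] y = coord k x ≢ coord k y

  row-col : ∀ {x y} → x ≈[ 0F ] y → x ≈[ 1F ] y → x ≡ y
  row-col {cell _ _ _ refl} {cell _ _ _ refl} refl refl = refl

  row-symbol : ∀ {x y} → x ≈[ 0F ] y → x ≈[ 2F ] y → x ≡ y
  row-symbol {cell i _ k p} {cell _ _ _ q} refl refl with row i k
  ... | _ , _ , unique = row-col refl (trans (sym (unique p)) (unique q))

  col-symbol : ∀ {x y} → x ≈[ 1F ] y → x ≈[ 2F ] y → x ≡ y
  col-symbol {cell _ j k p} {cell _ _ _ q} refl refl with column j k
  ... | _ , _ , unique = row-col (trans (sym (unique p)) (unique q)) refl

  two-lines : ∀ {k l x y} → k ≢ l → x ≈[ k ] y → x ≈[ l ] y → x ≡ y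
  two-lines {0F} {0F} k≢l p q = contradiction refl k≢l
  two-lines {0F} {1F} k≢l p q = row-col p q
  two-lines {0F} {2F} k≢l p q = row-symbol p q
  two-lines {1F} {0F} k≢l p q = row-col q p
  two-lines {1F} {1F} k≢l p q = contradiction refl k≢l
  two-lines {1F} {2F} k≢l p q = col-symbol p q
  two-lines {2F} {0F} k≢l p q = row-symbol q p
  two-lines {2F} {1F} k≢l p q = col-symbol q p
  two-lines {2F} {2F} k≢l p q = contradiction refl k≢l

  meet : ∀ {k l} → k ≢ l → ∀ p q → ∃ λ x → coord k x ≡ p × coord l x ≡ q
  meet {0F} {0F} k≢l p q = contradiction refl k≢l
  meet {0F} {1F} k≢l p q = cell p q _ refl , refl , refl
  meet {0F} {2F} k≢l p q = cell p _ q (proj₁ (proj₂ (row p q))) , refl , refl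
  meet {1F} {1F} k≢l p q = contradiction refl k≢l
  meet {1F} {2F} k≢l p q = cell _ p q (proj₁ (proj₂ (column p q))) , refl , refl
  meet {2F} {2F} k≢l p q = contradiction refl k≢l
  meet {1F} {0F} k≢l p q = cell q p _ refl , refl , refl
  meet {2F} {0F} k≢l p q = cell q _ p (proj₁ (proj₂ (row q p))) , refl , refl
  meet {2F} {1F} k≢l p q = cell _ q p (proj₁ (proj₂ (column q p))) , refl , refl

  infix 4 _≟ₚ_
  _≟ₚ_ : DecidableEquality Point
  x ≟ₚ y = map′ (λ (p , q) → row-col p q) (λ { refl → refl , refl })
    ((rowOf x ≟ rowOf y) ×-dec (colOf x ≟ colOf y))

  adjacent : ∀ {x y} k → x ≢ y → x ≈[ k ] y → x ~ y
  adjacent 0F x≢y p = x≢y , inj₁ p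
  adjacent 1F x≢y p = x≢y , inj₂ (inj₁ p)
  adjacent 2F x≢y p = x≢y , inj₂ (inj₂ p)

  direction : ∀ {x y} → x ~ y → ∃ λ k → x ≈[ k ] y
  direction (_ , inj₁ p)        = 0F , p
  direction (_ , inj₂ (inj₁ p)) = 1F , p
  direction (_ , inj₂ (inj₂ p)) = 2F , p

  -- Upper bound: shattered families.

  ShatteredFamily : ∀ {n} → (Fin n → Point) → Set
  ShatteredFamily q = ∀ (P : _ → Bool) → ∃ λ v → ∀ i → Reflects (v ~ q i) (P i)

  -- Passing from lists to indexed families with Boolean cuts lets members be permuted and counted
  -- by index. Injectivity ensures that the list built from the cut `P` contains `q i` only if `P i`
  -- is true.
  shatteredFamily : ∀ {S n} → Shattered S → (q : Fin n → Point) →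
    Injective _≡_ _≡_ q → (∀ i → q i ∈ S) → ShatteredFamily q
  shatteredFamily {S} {n} shattered q q-inj q∈S P
    with shattered (map q (filter (T? ∘ P) (allFin n)))
           (λ y∈ → let i , _ , y≡ = ∈-map⁻ q y∈ in subst (_∈ S) (sym y≡) (q∈S i))
  ... | v , to , from = v , λ i → fromEquivalence
    (λ t → proj₁ (from (∈-map⁺ q (∈-filter⁺ (T? ∘ P) (∈-allFin i) t))))
    (λ v~qi → let j , j∈ , eq = ∈-map⁻ q (to (v~qi , q∈S i)) in
       subst (T ∘ P) (sym (q-inj eq)) (proj₂ (∈-filter⁻ (T? ∘ P) {xs = allFin n} j∈)))

  -- Serves for arguments without loss of generality: any two members can be moved to the front, and
  -- any other into third place.
  permute : ∀ {n} {q : Fin n → Point} (π : Permutation′ n) →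
    ShatteredFamily q → ShatteredFamily (q ∘ (π ⟨$⟩ʳ_))
  permute π fam P with fam (P ∘ (π ⟨$⟩ˡ_))
  ... | v , trace = v , λ i → subst (Reflects _) (cong P (Perm.inverseˡ π)) (trace (π ⟨$⟩ʳ i))

  -- The singleton cut at `i` separates `q i` from every other member.
  members-distinct : ∀ {n} {q : Fin n → Point} → ShatteredFamily q → ∀ {i j} → i ≢ j → q i ≢ q j
  members-distinct {q = q} fam {i} {j} i≢j qi≡qj with fam (λ k → does (i ≟ k))
  ... | v , trace = i≢j (Reflects-transfer (trace j) (proof (i ≟ j))
    (subst (v ~_) qi≡qj (Reflects-transfer (proof (i ≟ i)) (trace i) refl)))

  -- The possible traces on `q 3F` and `q 4F`. The full trace comes last, so that `inject₁` from
  -- `Fin 3` enumerates exactly those that omit a member.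
  tails : Fin 4 → Vec Bool 2
  tails 0F = false ∷ false ∷ []
  tails 1F = true  ∷ false ∷ []
  tails 2F = false ∷ true  ∷ []
  tails 3F = true  ∷ true  ∷ []

  untails : Vec Bool 2 → Fin 4
  untails (false ∷ false ∷ []) = 0F
  untails (true  ∷ false ∷ []) = 1F
  untails (false ∷ true  ∷ []) = 2F
  untails (true  ∷ true  ∷ []) = 3F

  untails-tails : ∀ i → untails (tails i) ≡ i
  untails-tails 0F = refl
  untails-tails 1F = refl
  untails-tails 2F = refl
  untails-tails 3F = refl

  tails-injective : Injective _≡_ _≡_ tails
  tails-injective {i} {j} eq = trans (sym (untails-tails i)) (trans (cong untails eq) (untails-tails j))

  -- Five points with two of them on a common line.

  module CollinearPair {q : Fin 5 → Point} (fam : ShatteredFamily q)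
                       {k : Fin 3} (collinear : q 0F ≈[ k ] q 1F) where

    cut : Bool → Fin 4 → Point
    cut b w = proj₁ (fam (Vec.lookup (true ∷ true ∷ b ∷ tails w)))

    trace : ∀ b w i → Reflects (cut b w ~ q i) (Vec.lookup (true ∷ true ∷ b ∷ tails w) i)
    trace b w = proj₂ (fam (Vec.lookup (true ∷ true ∷ b ∷ tails w)))

    cut-injective : ∀ b {w w′} → cut b w ≡ cut b w′ → w ≡ w′
    cut-injective b {w} {w′} eq = tails-injective (ext (same 3F) (same 4F))
      where
      same : ∀ i → Vec.lookup (true ∷ true ∷ b ∷ tails w) i ≡ Vec.lookup (true ∷ true ∷ b ∷ tails w′) i
      same i = det (subst (λ v → Reflects (v ~ q i) _) eq (trace b w i)) (trace b w′ i)
      ext : ∀ {u v : Vec Bool 2} → Vec.lookup u 0F ≡ Vec.lookup v 0F →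
            Vec.lookup u 1F ≡ Vec.lookup v 1F → u ≡ v
      ext {_ ∷ _ ∷ []} {_ ∷ _ ∷ []} refl refl = refl

    cut~0 : ∀ b w → cut b w ~ q 0F
    cut~0 b w = invert (trace b w 0F)
    cut~1 : ∀ b w → cut b w ~ q 1F
    cut~1 b w = invert (trace b w 1F)

    -- `punchIn k` enumerates the two directions other than `k`. A vertex off the line is labelled
    -- by the direction in which it meets `q 0F`, a vertex on the line by the direction in which it
    -- meets `q 2F`.
    OffLine OnLine : Point → Fin 2 → Set
    OffLine v l = v ≉[ k ] q 0F × v ~ q 1F × v ≈[ punchIn k l ] q 0F
    OnLine  v l = v ≈[ k ] q 0F × v ≈[ punchIn k l ] q 2F

    offLine-label : ∀ {v} → v ≉[ k ] q 0F → v ~ q 0F → v ~ q 1F → ∃ (OffLine v)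
    offLine-label {v} off v~0 v~1 with direction v~0
    ... | l , eq = punchOut k≢l , off , v~1 ,
      subst (λ l → v ≈[ l ] q 0F) (sym (punchIn-punchOut k≢l)) eq
      where
      k≢l : k ≢ l
      k≢l refl = off eq

    -- A common neighbour off the line meets q 0 and q 1 in the two other directions, in one of two orders.
    offLine-functional : ∀ {v w l} → OffLine v l → OffLine w l → v ≡ w
    offLine-functional {v} {w} {l} (off , v~1 , p) (off′ , w~1 , p′)
      with direction v~1 | direction w~1
    ... | d , e | d′ , e′ = two-lines {l = d} (l≢ {v} off p e) (trans p (sym p′))
      (trans e (trans (cong (λ d → coord d (q 1F)) d≡d′) (trans (sym e′) (cong (λ d → coord d w) (sym d≡d′)))))
      where
      l≢ : ∀ {x d} → x ≉[ k ] q 0F → x ≈[ punchIn k l ] q 0F → x ≈[ d ] q 1F → punchIn k l ≢ d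
      l≢ _ p e refl = members-distinct fam {0F} {1F} (λ ()) (two-lines (punchInᵢ≢i k l ∘ sym) collinear (trans (sym p) e))
      k≢ : ∀ {x d} → x ≉[ k ] q 0F → x ≈[ d ] q 1F → k ≢ d
      k≢ off e refl = off (trans e (sym collinear))
      d≡d′ : d ≡ d′
      d≡d′ = third-unique (punchInᵢ≢i k l ∘ sym) (k≢ {v} off e) (k≢ {w} off′ e′)
        (l≢ {v} off p e) (l≢ {w} off′ p′ e′)

    onLine-label : ∀ {v} → q 2F ≉[ k ] q 0F → v ≈[ k ] q 0F → v ~ q 2F → ∃ (OnLine v)
    onLine-label {v} 2∉ on v~2 with direction v~2
    ... | l , eq = punchOut k≢l , on ,
      subst (λ l → v ≈[ l ] q 2F) (sym (punchIn-punchOut k≢l)) eq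
      where
      k≢l : k ≢ l
      k≢l refl = 2∉ (trans (sym eq) on)

    onLine-functional : ∀ {v w l} → OnLine v l → OnLine w l → v ≡ w
    onLine-functional {l = l} (on , p) (on′ , p′) =
      two-lines (punchInᵢ≢i k l ∘ sym) (trans on (sym on′)) (trans p (sym p′))

    -- Were `q 2F` on the line, a vertex of the line not adjacent to it would have to be `q 2F`
    -- itself. With the two off-line positions this makes three labels for four cuts.
    not-collinear : q 2F ≉[ k ] q 0F
    not-collinear 2∈ =
      let i , j , i<j , eq = crowded Label functional ≤-refl (cut false) label
      in <⇒≢ i<j (cut-injective false eq)
      where
      Label : Point → Fin 3 → Set
      Label v 0F      = v ≡ q 2F
      Label v (suc l) = OffLine v l
      functional : ∀ {v w l} → Label v l → Label w l → v ≡ w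
      functional {l = 0F}    p p′ = trans p (sym p′)
      functional {l = suc l} p p′ = offLine-functional p p′
      label : ∀ w → ∃ (Label (cut false w))
      label w with coord k (cut false w) ≟ coord k (q 0F) | cut false w ≟ₚ q 2F
      ... | no off | _      = let l , p = offLine-label off (cut~0 false w) (cut~1 false w) in suc l , p
      ... | yes _  | yes eq = 0F , eq
      ... | yes on | no  ≢2 = contradiction (adjacent k ≢2 (trans on (sym 2∈))) (invert (trace false w 2F))

    -- If `v` were not adjacent to `q 2F`, it would differ from the four vertices `cut true w`: five
    -- vertices for two off-line and two on-line positions. The argument refutes non-adjacency,
    -- hence the double negation, which suffices where only a contradiction is sought.
    offLine-adjacent : ∀ {v} → v ≉[ k ] q 0F → v ~ q 0F → v ~ q 1F → ¬ ¬ v ~ q 2F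
    offLine-adjacent {v} off v~0 v~1 v≁2 =
      let i , j , i<j , eq = crowded Label functional ≤-refl vertex label in distinct i j i<j eq
      where
      vertex : Fin 5 → Point
      vertex zero    = v
      vertex (suc w) = cut true w
      distinct : ∀ i j → i Fin.< j → vertex i ≢ vertex j
      distinct zero    (suc w) _   eq = v≁2 (subst (_~ q 2F) (sym eq) (invert (trace true w 2F)))
      distinct (suc i) (suc j) i<j eq = <⇒≢ i<j (cong suc (cut-injective true eq))
      Label : Point → Fin 4 → Set
      Label v 0F            = OffLine v 0F
      Label v 1F            = OffLine v 1F
      Label v (suc (suc l)) = OnLine v l
      functional : ∀ {v w l} → Label v l → Label w l → v ≡ w
      functional {l = 0F}          = offLine-functional
      functional {l = 1F}          = offLine-functional
      functional {l = suc (suc l)} = onLine-functional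
      offLabel : ∀ {v} → ∃ (OffLine v) → ∃ (Label v)
      offLabel (0F , p) = 0F , p
      offLabel (1F , p) = 1F , p
      label : ∀ i → ∃ (Label (vertex i))
      label zero    = offLabel (offLine-label off v~0 v~1)
      label (suc w) with coord k (cut true w) ≟ coord k (q 0F)
      ... | no  off = offLabel (offLine-label off (cut~0 true w) (cut~1 true w))
      ... | yes on  = let l , p = onLine-label not-collinear on (invert (trace true w 2F)) in suc (suc l) , p

  no-collinear-pair : ∀ {q : Fin 5 → Point} → ShatteredFamily q → ∀ {k} → q 0F ≉[ k ] q 1F
  no-collinear-pair {q} fam {k} collinear =
    let i , j , i<j , eq = crowded OnLine onLine-functional ≤-refl (cut true ∘ inject₁) label
    in <⇒≢ i<j (Fin.inject₁-injective (cut-injective true eq))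
    where
    open CollinearPair fam {k} collinear
    -- The transposition puts `q 3F` in the place of `q 2F` and fixes the collinear pair;
    -- `adjacent₄` does the same with `q 4F`.
    adjacent₃ : ∀ {v} → v ≉[ k ] q 0F → v ~ q 0F → v ~ q 1F → ¬ ¬ v ~ q 3F
    adjacent₃ = CollinearPair.offLine-adjacent (permute (transpose 2F 3F) fam) {k} collinear
    adjacent₄ : ∀ {v} → v ≉[ k ] q 0F → v ~ q 0F → v ~ q 1F → ¬ ¬ v ~ q 4F
    adjacent₄ = CollinearPair.offLine-adjacent (permute (transpose 2F 4F) fam) {k} collinear
    -- Each of these three cuts omits `q 3F` or `q 4F`, so its vertex cannot be off the line.
    -- Decidable equality of coordinates removes the double negation.
    on : ∀ (w : Fin 3) → cut true (inject₁ w) ≈[ k ] q 0F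
    on w = decidable-stable (_ ≟ _) λ off → not-full w
      (adjacent₃ off (cut~0 true _) (cut~1 true _)) (adjacent₄ off (cut~0 true _) (cut~1 true _))
      where
      not-full : ∀ w → ¬ ¬ cut true (inject₁ w) ~ q 3F → ¬ ¬ cut true (inject₁ w) ~ q 4F → ⊥
      not-full 0F p _ = p (invert (trace true 0F 3F))
      not-full 1F _ p = p (invert (trace true 1F 4F))
      not-full 2F p _ = p (invert (trace true 2F 3F))
    label : ∀ w → ∃ (OnLine (cut true (inject₁ w)))
    label w = onLine-label not-collinear (on w) (invert (trace true (inject₁ w) 2F))

  -- The vertex adjacent to all five members meets them in only three directions, so two of them
  -- share a line through it.
  no-shattered-five : {q : Fin 5 → Point} → ¬ ShatteredFamily q
  no-shattered-five {q} fam with fam (λ _ → true)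
  ... | v , trace with pigeonhole (from-yes (3 <? 5)) (λ i → proj₁ (direction (invert (trace i))))
  ... | i , j , i<j , eq = no-collinear-pair (permute π fam) {k}
          (trans (sym (proj₂ (dir i)))
            (trans (subst (λ k → v ≈[ k ] q j) (sym eq) (proj₂ (dir j)))
              (cong (coord k ∘ q) (sym (punchIn-punchOut i≢j)))))
    where
    dir : ∀ i → ∃ λ k → v ≈[ k ] q i
    dir i = direction (invert (trace i))
    k = proj₁ (dir i)
    i≢j = <⇒≢ i<j
    π : Permutation′ 5
    -- Sends `0F` to `i` and `1F` to `punchIn i (punchOut i≢j)`, which is `j`.
    π = insert 0F i (insert 0F (punchOut i≢j) Perm.id)

  shattered-length : ∀ S → Unique S → Shattered S → length S ≤ 4
  shattered-length S unique shattered = ≮⇒≥ λ 4<∣S∣ → no-shattered-five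
    (shatteredFamily shattered (λ i → lookup S (inject≤ i 4<∣S∣))
      (λ eq → Fin.inject≤-injective 4<∣S∣ 4<∣S∣ _ _ (lookup-injective unique eq)) (λ i → ∈-lookup _))

  -- Lower bound: realising the sixteen cuts of four points.

  Cut : (a b c d : Point) (p q r s : Bool) → Set
  Cut a b c d p q r s = ∃ λ v →
    Reflects (v ~ a) p × Reflects (v ~ b) q × Reflects (v ~ c) r × Reflects (v ~ d) s

  cuts⇒shattered : ∀ {a b c d} → (∀ p q r s → Cut a b c d p q r s) → Shattered (a ∷ b ∷ c ∷ d ∷ [])
  cuts⇒shattered {a} {b} {c} {d} cuts A A⊆S
    with cuts (does (a ∈? A)) (does (b ∈? A)) (does (c ∈? A)) (does (d ∈? A))
    where open DecMembership _≟ₚ_ using (_∈?_)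
  ... | v , ra , rb , rc , rd = v , to , λ y∈A → from (A⊆S y∈A) y∈A , A⊆S y∈A
    where
    open DecMembership _≟ₚ_ using (_∈?_)
    to : ∀ {y} → v ~ y × y ∈ (a ∷ b ∷ c ∷ d ∷ []) → y ∈ A
    to (v~y , here refl)                         = Reflects-transfer ra (proof (a ∈? A)) v~y
    to (v~y , there (here refl))                 = Reflects-transfer rb (proof (b ∈? A)) v~y
    to (v~y , there (there (here refl)))         = Reflects-transfer rc (proof (c ∈? A)) v~y
    to (v~y , there (there (there (here refl)))) = Reflects-transfer rd (proof (d ∈? A)) v~y
    from : ∀ {y} → y ∈ (a ∷ b ∷ c ∷ d ∷ []) → y ∈ A → v ~ y
    from (here refl)                         = Reflects-transfer (proof (a ∈? A)) ra
    from (there (here refl))                 = Reflects-transfer (proof (b ∈? A)) rb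
    from (there (there (here refl)))         = Reflects-transfer (proof (c ∈? A)) rc
    from (there (there (there (here refl)))) = Reflects-transfer (proof (d ∈? A)) rd

  -- A line has `m` points and the most constrained choice below, that of `d`, has ten lines to
  -- avoid; this is the origin of eleven.
  module FourPoints (11≤m : 11 ≤ m) where

    Avoids : ∀ {k} → List ((∃ λ l → k ≢ l) × Point) → Point → Set
    Avoids []                  x = ⊤
    Avoids (((l , _) , y) ∷ F) x = x ≉[ l ] y × Avoids F x

    -- Each listed line meets the line through u in direction k in a single point.
    avoid : ∀ k u (F : List ((∃ λ l → k ≢ l) × Point)) {small : True (length F ≤? 10)} →
            ∃ λ x → x ≈[ k ] u × Avoids F x
    avoid k u F {small} =
      let p , p∉ = fresh (map foot F)
            (subst (_< m) (sym (length-map foot F)) (≤-<-trans (toWitness small) 11≤m))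
          x , x∈k , x≡p = meet k≢l₀ (coord k u) p
      in x , x∈k , avoids F x x∈k (subst (_∉ map foot F) (sym x≡p) p∉)
      where
      l₀ : Fin 3
      -- A point on a line in direction `k` is determined by its coordinate in any other direction,
      -- so `l₀` serves to number the points of the line.
      l₀ = punchIn k 0F
      k≢l₀ : k ≢ l₀
      k≢l₀ = ≢-sym (punchInᵢ≢i k 0F)
      foot : (∃ λ l → k ≢ l) × Point → Fin m
      foot ((l , k≢l) , y) = coord l₀ (proj₁ (meet k≢l (coord k u) (coord l y)))
      foot-unique : ∀ {l} k≢l y {x} → x ≈[ k ] u → x ≈[ l ] y → coord l₀ x ≡ foot ((l , k≢l) , y)
      foot-unique {l} k≢l y x∈k x∈l =
        let _ , w∈k , w∈l = meet k≢l (coord k u) (coord l y)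
        in cong (coord l₀) (two-lines k≢l (trans x∈k (sym w∈k)) (trans x∈l (sym w∈l)))
      avoids : ∀ F x → x ≈[ k ] u → coord l₀ x ∉ map foot F → Avoids F x
      avoids []                    x x∈k x∉ = tt
      avoids (((l , k≢l) , y) ∷ F) x x∈k x∉ =
        (λ x∈l → x∉ (here (foot-unique k≢l y x∈k x∈l))) , avoids F x x∈k (x∉ ∘ there)

    -- General position: neither `a` nor `b` shares a line with `c` or `d`. The directions are
    -- parameters so that exchanging the two arms of the cross is a symmetry.
    record Cross (α β γ : Fin 3) (u a b c d : Point) : Set where
      field
        α≢β : α ≢ β
        α≢γ : α ≢ γ
        β≢γ : β ≢ γ
        αa  : a ≈[ α ] u
        αb  : b ≈[ α ] u
        βc  : c ≈[ β ] u
        βd  : d ≈[ β ] u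
        βa≢u : a ≉[ β ] u
        βb≢u : b ≉[ β ] u
        βa≢b : a ≉[ β ] b
        αc≢u : c ≉[ α ] u
        αd≢u : d ≉[ α ] u
        αc≢d : c ≉[ α ] d
        γa≢c : a ≉[ γ ] c
        γa≢d : a ≉[ γ ] d
        γb≢c : b ≉[ γ ] c
        γb≢d : b ≉[ γ ] d

    swap-ab : ∀ {α β γ u a b c d} → Cross α β γ u a b c d → Cross α β γ u b a c d
    swap-ab C = record
      { α≢β = α≢β ; α≢γ = α≢γ ; β≢γ = β≢γ ; αa = αb ; αb = αa ; βc = βc ; βd = βd
      ; βa≢u = βb≢u ; βb≢u = βa≢u ; βa≢b = ≢-sym βa≢b ; αc≢u = αc≢u ; αd≢u = αd≢u ; αc≢d = αc≢d
      ; γa≢c = γb≢c ; γa≢d = γb≢d ; γb≢c = γa≢c ; γb≢d = γa≢d }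
      where open Cross C

    -- Together with `swap-ab` this reduces the sixteen cuts to six shapes: empty, `a`, `ab`, `ac`,
    -- `abc` and `abcd`.
    transposed : ∀ {α β γ u a b c d} → Cross α β γ u a b c d → Cross β α γ u c d a b
    transposed C = record
      { α≢β = ≢-sym α≢β ; α≢γ = β≢γ ; β≢γ = α≢γ ; αa = βc ; αb = βd ; βc = αa ; βd = αb
      ; βa≢u = αc≢u ; βb≢u = αd≢u ; βa≢b = αc≢d ; αc≢u = βa≢u ; αd≢u = βb≢u ; αc≢d = βa≢b
      ; γa≢c = ≢-sym γa≢c ; γa≢d = ≢-sym γb≢c ; γb≢c = ≢-sym γa≢d ; γb≢d = ≢-sym γb≢d }
      where open Cross C

    module Cuts {α β γ u a b c d} (C : Cross α β γ u a b c d) where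
      open Cross C

      near : ∀ {x y} k l → x ≉[ l ] y → x ≈[ k ] y → Reflects (x ~ y) true
      near k l x≢y eq = ofʸ (adjacent k (λ x≡y → x≢y (cong (coord l) x≡y)) eq)

      apart : ∀ {x y} → x ≉[ α ] y → x ≉[ β ] y → x ≉[ γ ] y → Reflects (x ~ y) false
      apart {x} {y} α≢ β≢ γ≢ = ofⁿ λ x~y → let k , eq = direction x~y in not-in k eq
        where
        not-in : ∀ k → x ≉[ k ] y
        not-in k eq with α ≟ k | β ≟ k
        ... | yes refl | _        = α≢ eq
        ... | no  _    | yes refl = β≢ eq
        ... | no  α≢k  | no  β≢k  with third-unique α≢β α≢k α≢γ β≢k β≢γ
        ... | refl = γ≢ eq

      α-β : ∃ λ l → α ≢ l
      α-β = β , α≢β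
      α-γ : ∃ λ l → α ≢ l
      α-γ = γ , α≢γ
      β-α : ∃ λ l → β ≢ l
      β-α = α , ≢-sym α≢β
      β-γ : ∃ λ l → β ≢ l
      β-γ = γ , β≢γ

      ≢-via : ∀ {A : Set} {x y z : A} → x ≡ y → y ≢ z → x ≢ z
      ≢-via refl y≢z = y≢z

      cut-∅ : Cut a b c d false false false false
      cut-∅ =
        -- `avoid` moves along one line only, so a generic point of the square takes two choices:
        -- `y` fixes the α-line, then `x` is chosen on it.
        case avoid β u ((β-α , u) ∷ (β-α , c) ∷ (β-α , d) ∷ []) of λ (y , _ , αu , αc , αd , _) →
        case avoid α y ((α-β , u) ∷ (α-β , a) ∷ (α-β , b) ∷ (α-γ , a) ∷ (α-γ , b) ∷ (α-γ , c) ∷ (α-γ , d) ∷ [])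
          of λ (x , αx , βu , βa , βb , γa , γb , γc , γd , _) → x ,
        apart (λ e → αu (trans (sym αx) (trans e αa))) βa γa ,
        apart (λ e → αu (trans (sym αx) (trans e αb))) βb γb ,
        apart (≢-via αx αc) (λ e → βu (trans e βc)) γc ,
        apart (≢-via αx αd) (λ e → βu (trans e βd)) γd

      cut-a : Cut a b c d true false false false
      cut-a =
        case avoid β a ((β-α , u) ∷ (β-α , c) ∷ (β-α , d) ∷ (β-γ , b) ∷ (β-γ , c) ∷ (β-γ , d) ∷ [])
          of λ (x , βx , αu , αc , αd , γb , γc , γd , _) → x ,
        near β α (λ e → αu (trans e αa)) βx ,
        apart (λ e → αu (trans e αb)) (≢-via βx βa≢b) γb ,
        apart αc (λ e → βa≢u (trans (sym βx) (trans e βc))) γc ,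
        apart αd (λ e → βa≢u (trans (sym βx) (trans e βd))) γd

      cut-ab : Cut a b c d true true false false
      cut-ab =
        case avoid α u ((α-β , u) ∷ (α-β , a) ∷ (α-β , b) ∷ (α-γ , c) ∷ (α-γ , d) ∷ [])
          of λ (x , αx , βu , βa , βb , γc , γd , _) → x ,
        near α β βa (trans αx (sym αa)) ,
        near α β βb (trans αx (sym αb)) ,
        apart (≢-via αx (≢-sym αc≢u)) (λ e → βu (trans e βc)) γc ,
        apart (≢-via αx (≢-sym αd≢u)) (λ e → βu (trans e βd)) γd

      cut-abc : Cut a b c d true true true false
      cut-abc with meet α≢γ (coord α u) (coord γ c)
      ... | x , αx , γx = x ,
        near α γ (≢-via γx (≢-sym γa≢c)) (trans αx (sym αa)) ,
        near α γ (≢-via γx (≢-sym γb≢c)) (trans αx (sym αb)) ,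
        near γ α (≢-via αx (≢-sym αc≢u)) γx ,
        -- A γ-line shared with `d` would also contain `c`, forcing `c` and `d` to coincide. A
        -- β-line shared with `d` would force `x` to be `c`, placing `c` on the α-line of `u`.
        apart (≢-via αx (≢-sym αd≢u)) x≉βd (λ e → αc≢d (cong (coord α)
          (two-lines β≢γ (trans βc (sym βd)) (trans (sym γx) e))))
        where
        x≉βd : x ≉[ β ] d
        x≉βd e = αc≢u (trans (sym (cong (coord α) (two-lines β≢γ (trans e (trans βd (sym βc))) γx))) αx)

      cut-abcd : Cut a b c d true true true true
      cut-abcd = u ,
        near α β (≢-sym βa≢u) (sym αa) , near α β (≢-sym βb≢u) (sym αb) ,
        near β α (≢-sym αc≢u) (sym βc) , near β α (≢-sym αd≢u) (sym βd)

      -- Two coordinates of the corner are prescribed, so there is no freedom left to avoid the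
      -- γ-lines of `b` and `d`. That has to be arranged when the four points are chosen, and enters
      -- here as a hypothesis.
      cut-ac : (∃ λ x → x ≈[ α ] c × x ≈[ β ] a × x ≉[ γ ] b × x ≉[ γ ] d) →
               Cut a b c d true false true false
      cut-ac (x , αx , βx , γb , γd) = x ,
        near β α (λ e → αc≢u (trans (sym αx) (trans e αa))) βx ,
        apart (λ e → αc≢u (trans (sym αx) (trans e αb))) (≢-via βx βa≢b) γb ,
        near α β (λ e → βa≢u (trans (sym βx) (trans e βc))) αx ,
        apart (≢-via αx αc≢d) (λ e → βa≢u (trans (sym βx) (trans e βd))) γd

    flip-ab : ∀ {a b c d p q r s} → Cut b a c d q p r s → Cut a b c d p q r s
    flip-ab (v , rb , ra , rc , rd) = v , ra , rb , rc , rd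

    flip-transposed : ∀ {a b c d p q r s} → Cut c d a b r s p q → Cut a b c d p q r s
    flip-transposed (v , rc , rd , ra , rb) = v , ra , rb , rc , rd

    swap-cd : ∀ {α β γ u a b c d} → Cross α β γ u a b c d → Cross α β γ u a b d c
    swap-cd = transposed ∘ swap-ab ∘ transposed

    flip-cd : ∀ {a b c d p q r s} → Cut a b d c p q s r → Cut a b c d p q r s
    flip-cd (v , ra , rb , rd , rc) = v , ra , rb , rc , rd

    Corner : (a b c d : Point) → Set
    Corner a b c d = ∃ λ x → x ≈[ 0F ] c × x ≈[ 1F ] a × x ≉[ 2F ] b × x ≉[ 2F ] d

    cross-shattered : ∀ {u a b c d} → Cross 0F 1F 2F u a b c d →
      Corner a b c d → Corner a b d c → Corner b a c d → Corner b a d c →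
      ∃ λ S → Unique S × length S ≡ 4 × Shattered S
    cross-shattered {u} {a} {b} {c} {d} C ac ad bc bd =
      a ∷ b ∷ c ∷ d ∷ [] ,
      (differ 1F βa≢b ∷ differ 2F γa≢c ∷ differ 2F γa≢d ∷ []) ∷
      (differ 2F γb≢c ∷ differ 2F γb≢d ∷ []) ∷
      (differ 0F αc≢d ∷ []) ∷ [] ∷ [] ,
      refl , cuts⇒shattered cuts
      where
      open Cross C
      differ : ∀ {x y} k → x ≉[ k ] y → x ≢ y
      differ k x≢y refl = x≢y refl
      cuts : ∀ p q r s → Cut a b c d p q r s
      cuts false false false false = Cuts.cut-∅ C
      cuts true  false false false = Cuts.cut-a C
      cuts false true  false false = flip-ab (Cuts.cut-a (swap-ab C))
      cuts false false true  false = flip-transposed (Cuts.cut-a (transposed C))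
      cuts false false false true  = flip-transposed (flip-ab (Cuts.cut-a (swap-ab (transposed C))))
      cuts true  true  false false = Cuts.cut-ab C
      cuts false false true  true  = flip-transposed (Cuts.cut-ab (transposed C))
      cuts true  false true  false = Cuts.cut-ac C ac
      cuts true  false false true  = flip-cd (Cuts.cut-ac (swap-cd C) ad)
      cuts false true  true  false = flip-ab (Cuts.cut-ac (swap-ab C) bc)
      cuts false true  false true  = flip-cd (flip-ab (Cuts.cut-ac (swap-ab (swap-cd C)) bd))
      cuts true  true  true  false = Cuts.cut-abc C
      cuts true  true  false true  = flip-cd (Cuts.cut-abc (swap-cd C))
      cuts true  false true  true  = flip-transposed (Cuts.cut-abc (transposed C))
      cuts false true  true  true  = flip-ab (flip-transposed (Cuts.cut-abc (transposed (swap-ab C))))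
      cuts true  true  true  true  = Cuts.cut-abcd C

    -- Choosing the four points.

    column₀ : ∃ λ (l : Fin 3) → 0F ≢ l
    column₀ = 1F , λ ()

    row₁ symbol₁ : ∃ λ (l : Fin 3) → 1F ≢ l
    row₁    = 0F , λ ()
    symbol₁ = 2F , λ ()

    onColumn : ∀ a b → ∃ λ x → x ≈[ 1F ] a × x ≈[ 2F ] b
    onColumn a b = meet {1F} {2F} (λ ()) (colOf a) (symbolOf b)

    onRow : ∀ c a → ∃ λ x → x ≈[ 0F ] c × x ≈[ 1F ] a
    onRow c a = meet {0F} {1F} (λ ()) (rowOf c) (colOf a)

    -- If `x` had the symbol of `b`, it would share column and symbol with `y` and so equal it. A
    -- condition on the symbol of a corner thus becomes a condition on the row of `c`, which `avoid`
    -- can impose.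
    corner-symbol : ∀ {a b c x y} → x ≈[ 0F ] c × x ≈[ 1F ] a → y ≈[ 1F ] a × y ≈[ 2F ] b →
                    c ≉[ 0F ] y → x ≉[ 2F ] b
    corner-symbol {x = x} {y} (0x , 1x) (1y , 2y) c≢y 2x =
      c≢y (trans (sym 0x) (cong rowOf (col-symbol {x} {y} (trans 1x (sym 1y)) (trans 2x (sym 2y)))))

    shattered-four : Point → ∃ λ S → Unique S × length S ≡ 4 × Shattered S
    shattered-four u =
      case avoid 0F u ((column₀ , u) ∷ []) of λ (a , 0a , 1a≢u , _) →
      case avoid 0F u ((column₀ , u) ∷ (column₀ , a) ∷ []) of λ (b , 0b , 1b≢u , 1b≢a , _) →
      case onColumn a b of λ (ab , ab∈) → case onColumn b a of λ (ba , ba∈) →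
      -- The rows of `ab` and `ba` are avoided so that the corner `ca` lacks the symbol of `b`, and
      -- `cb` that of `a`.
      case avoid 1F u ((row₁ , u) ∷ (symbol₁ , a) ∷ (symbol₁ , b) ∷ (row₁ , ab) ∷ (row₁ , ba) ∷ [])
        of λ (c , 1c , 0c≢u , 2c≢a , 2c≢b , c≢ab , c≢ba , _) →
      case onColumn a c of λ (ac , ac∈) → case onColumn b c of λ (bc , bc∈) →
      case onRow c a of λ (ca , ca∈) → case onRow c b of λ (cb , cb∈) →
      -- The four rows of `ab`, `ba`, `ac`, `bc` control the symbols of the corners `da` and `db`;
      -- the symbols of `ca` and `cb` are avoided by `d` itself.
      case avoid 1F u ((row₁ , u) ∷ (row₁ , c) ∷ (symbol₁ , a) ∷ (symbol₁ , b) ∷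
                       (row₁ , ab) ∷ (row₁ , ba) ∷ (row₁ , ac) ∷ (row₁ , bc) ∷
                       (symbol₁ , ca) ∷ (symbol₁ , cb) ∷ [])
        of λ (d , 1d , 0d≢u , 0d≢c , 2d≢a , 2d≢b , d≢ab , d≢ba , d≢ac , d≢bc , d≢ca , d≢cb , _) →
      case onRow d a of λ (da , da∈) → case onRow d b of λ (db , db∈) →
      cross-shattered {u} {a} {b} {c} {d}
        (record
          { α≢β = λ () ; α≢γ = λ () ; β≢γ = λ () ; αa = 0a ; αb = 0b ; βc = 1c ; βd = 1d
          ; βa≢u = 1a≢u ; βb≢u = 1b≢u ; βa≢b = ≢-sym 1b≢a
          ; αc≢u = 0c≢u ; αd≢u = 0d≢u ; αc≢d = ≢-sym 0d≢c
          ; γa≢c = ≢-sym 2c≢a ; γa≢d = ≢-sym 2d≢a ; γb≢c = ≢-sym 2c≢b ; γb≢d = ≢-sym 2d≢b })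
        (ca , proj₁ ca∈ , proj₂ ca∈ , corner-symbol {a} {b} {c} {ca} {ab} ca∈ ab∈ c≢ab , ≢-sym d≢ca)
        (da , proj₁ da∈ , proj₂ da∈ ,
          corner-symbol {a} {b} {d} {da} {ab} da∈ ab∈ d≢ab , corner-symbol {a} {c} {d} {da} {ac} da∈ ac∈ d≢ac)
        (cb , proj₁ cb∈ , proj₂ cb∈ , corner-symbol {b} {a} {c} {cb} {ba} cb∈ ba∈ c≢ba , ≢-sym d≢cb)
        (db , proj₁ db∈ , proj₂ db∈ ,
          corner-symbol {b} {a} {d} {db} {ba} db∈ ba∈ d≢ba , corner-symbol {b} {c} {d} {db} {bc} db∈ bc∈ d≢bc)

15≤m : ∀ {m} → 225 ≤ m * m → 15 ≤ m
-- Otherwise `m` is at most 14, and `m * m` at most 196.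
15≤m {m} 225≤ = ≮⇒≥ λ { (s≤s m≤14) → from-no (225 ≤? 196) (≤-trans 225≤ (*-mono-≤ m≤14 m≤14)) }

theorem37 : (m : ℕ) (L : LatinSquare m) → 225 ≤ Graph.order (latinSquareGraph L) → VCDimension (latinSquareGraph L) 4
theorem37 zero    L ()
theorem37 (suc m) L 225≤ = record
  { attained = FourPoints.shattered-four L (≤-trans (from-yes (11 ≤? 15)) (15≤m {suc m} 225≤)) (cell zero zero _ refl)
  ; maximal  = shattered-length L
  }
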